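{- For integers $s\ge 3$ and $n\ge 2$, we have $f(s;n)\le 2^{5^s s!(\log n)^{s-2}}$.
   Context: For a coloring $\chi$ of the pairs of $[N]=\{1,\dots,N\}$ with integer colors, a triple $u<v<w$ is non-increasing if either $\chi(u,v)=\chi(u,w)\ge\chi(v,w)$ or $\chi(u,v)\ge\chi(v,w)=\chi(u,w)$; a set $S\subset[N]$ is non-increasing if all its triples are. $f(s;q)$ denotes the minimum $N$ such that for every coloring of the pairs of $[N]$ with at most $q$ colors $\kappa_1<\dots<\kappa_q$ (integers), there is a set $S\subset[N]$ of size $s$ that is non-increasing. Logarithms are base $2$. -}

module Defs where

open import Data.Nat using (ℕ; zero; suc; _+_; _*_; _^_; _≤_; _<_)
open import Data.Integer using (ℤ) renaming (_≤_ to _≤ℤ_)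
open import Data.Fin using (Fin)
open import Data.Product using (Σ; _×_; ∃)
open import Data.Sum using (_⊎_)
open import Relation.Binary.PropositionalEquality using (_≡_)

-- A colouring of the pairs of [N]: only the values χ u v with 1 ≤ u < v ≤ N matter.
Colouring : Set
Colouring = ℕ → ℕ → ℤ

AtMostColours : ℕ → ℕ → Colouring → Set
AtMostColours N q χ =
  Σ (Fin q → ℤ) λ κ → ∀ u v → 1 ≤ u → u < v → v ≤ N → ∃ λ i → χ u v ≡ κ i

NonIncTriple : Colouring → ℕ → ℕ → ℕ → Set
NonIncTriple χ u v w =
  (χ u v ≡ χ u w × χ v w ≤ℤ χ u v) ⊎ (χ v w ≤ℤ χ u v × χ v w ≡ χ u w)

IncSubset : (N s : ℕ) → (Fin s → ℕ) → Set
IncSubset N s S = (∀ i → 1 ≤ S i × S i ≤ N) × (∀ i j → Data.Fin._<_ i j → S i < S j)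
  where import Data.Fin

NonIncSet : Colouring → {s : ℕ} → (Fin s → ℕ) → Set
NonIncSet χ S = ∀ i j k → i Data.Fin.< j → j Data.Fin.< k → NonIncTriple χ (S i) (S j) (S k)
  where import Data.Fin

-- the Ramsey-type property defining f(s;q): every colouring of the pairs of [N]
-- with at most q colours has a non-increasing set of size s
Arrows : ℕ → ℕ → ℕ → Set
Arrows N s q = ∀ (χ : Colouring) → AtMostColours N q χ →
  Σ (Fin s → ℕ) λ S → IncSubset N s S × NonIncSet χ S

-- N ≤ 2^(c · (log₂ n)^k) for real log, k ≥ 1, expressed exactly without reals:
-- for all rationals p/q (q ≥ 1) with log₂ n < p/q (i.e. n^q < 2^p),
-- log₂ N ≤ c (p/q)^k (i.e. N^(q^k) ≤ 2^(c p^k)).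
-- (Equivalent to log₂ N ≤ c (log₂ n)^k by density of the rationals and continuity.)
BoundedByTwoPow : ℕ → ℕ → ℕ → ℕ → Set
BoundedByTwoPow N c n k =
  ∀ p q → 1 ≤ q → n ^ q < 2 ^ p → N ^ (q ^ k) ≤ 2 ^ (c * p ^ k)

-- f(s;n) ≤ 2^(5^s s! (log n)^(s-2)) : the minimum N with the property is at most the bound,
-- i.e. some N within the bound has the property.

{-# OPTIONS --safe #-}
module Submission where

{-
Replace the colours by their ranks, and cover them by bands, where band I carries a target size suc (rank I); we look
for a non-increasing set of the target size with all its colours in one of the bands.  Initially there is one band.

Call v < x < w bad if χ(v,x) ≥ χ(x,w) lie in a common band I.  If some v < w have many bad x in between, then many of
these have the same colours d = χ(v,x) ≥ c = χ(x,w).  Within this set of vertices split I at c into two bands of rank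
one less: a set with colours ≤ c extends by v, a set with colours > c extends by w.  The sum of 2^rank is invariant
under splitting, so with K = 2^(s-1) there are at most K bands and at most K splits.

If all pairs v < w have few bad x in between, averaging gives a long sequence of vertices without bad triples.  There,
label x for each band by the largest colour in that band of a pair ending at x.  As a path of two pairs within a band
has increasing colours, an edge u < x makes the labels of u and x differ in the band of χ(u,x), so the length of the
sequence is at most the number of label vectors, (n+2)^K.  The resulting bound on f(s;n) is polynomial in n.
-}

open import Defs
open import Data.Nat using (ℕ; _≤_; _∸_; _^_; _*_; _!)
open import Data.Product using (Σ; _×_)

open import Algebra.Properties.CommutativeSemigroup using (x∙yz≈y∙xz)
open import Data.Fin using (Fin; toℕ; fromℕ<; funToFin; finToFun)
import Data.Fin as Fin
import Data.Fin.Properties as Fin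
open import Data.Integer using (ℤ) renaming (_≤_ to _≤ℤ_)
import Data.Integer.Properties as ℤ
open import Data.List using (List; []; _∷_; _++_; length; filter; map; take; drop; lookup; applyUpTo; allFin)
open import Data.List.Membership.Propositional using (_∈_; find; lose)
open import Data.List.Membership.Propositional.Properties
  using (∈-filter⁻; ∈-++⁺ˡ; ∈-++⁺ʳ; ∈-++⁻; ∈-lookup; ∈-allFin; ∈-applyUpTo⁻)
open import Data.List.Properties
  using (length-filter; length-take; length-drop; length-++; length-tabulate; length-applyUpTo; take++drop≡id)
open import Data.List.Relation.Unary.All as All using (All; []; _∷_)
import Data.List.Relation.Unary.All.Properties as All
open import Data.List.Relation.Unary.AllPairs using (AllPairs; []; _∷_)
import Data.List.Relation.Unary.AllPairs.Properties as AllPairs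
open import Data.List.Relation.Unary.Any as Any using (Any; here; there; any?)
open import Data.List.Relation.Unary.Any.Properties using (lookup-index)
open import Data.Nat using (zero; suc; pred; _+_; _<_; _⊔_; z≤n; s≤s; >-nonZero; ≢-nonZero)
open import Data.Nat.ListAction using (sum)
open import Data.Nat.Properties
open import Data.Nat.Solver using (module +-*-Solver)
open import Data.Product using (∃; ∃₂; _,_; proj₁; proj₂)
open import Data.Sum using (_⊎_; inj₁; inj₂)
import Data.Sum as Sum
open import Function using (_∘_; id)
open import Relation.Binary.PropositionalEquality using (_≡_; _≢_; refl; sym; trans; cong; cong₂; subst)
open import Relation.Nullary using (¬_; Dec; yes; no; ¬?; contradiction)
open import Relation.Nullary.Decidable using (_×-dec_)
open import Relation.Unary using (Decidable)

-- Counting and averaging over lists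

private
  variable
    A B : Set

count : {P : A → Set} → Decidable P → List A → ℕ
count P? xs = length (filter P? xs)

count-∪ : {P Q R : A → Set} (P? : Decidable P) (Q? : Decidable Q) (R? : Decidable R) →
          (∀ x → R x → P x ⊎ Q x) → ∀ xs → count R? xs ≤ count P? xs + count Q? xs
count-∪ P? Q? R? R⊆P∪Q [] = z≤n
count-∪ P? Q? R? R⊆P∪Q (x ∷ xs) with count-∪ P? Q? R? R⊆P∪Q xs | R? x | P? x | Q? x
... | ih | yes r | yes _ | yes _ = s≤s (≤-trans ih (+-monoʳ-≤ (count P? xs) (n≤1+n _)))
... | ih | yes r | yes _ | no _  = s≤s ih
... | ih | yes r | no _  | yes _ = ≤-trans (s≤s ih) (≤-reflexive (sym (+-suc (count P? xs) _)))
... | ih | yes r | no ¬p | no ¬q = contradiction (R⊆P∪Q x r) Sum.[ ¬p , ¬q ]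
... | ih | no _  | yes _ | yes _ = m≤n⇒m≤1+n (≤-trans ih (+-monoʳ-≤ (count P? xs) (n≤1+n _)))
... | ih | no _  | yes _ | no _  = m≤n⇒m≤1+n ih
... | ih | no _  | no _  | yes _ = ≤-trans ih (+-monoʳ-≤ (count P? xs) (n≤1+n _))
... | ih | no _  | no _  | no _  = ih

count-complement : {P : A → Set} (P? : Decidable P) → ∀ xs → count P? xs + count (¬? ∘ P?) xs ≡ length xs
count-complement P? [] = refl
count-complement P? (x ∷ xs) with P? x
... | yes _ = cong suc (count-complement P? xs)
... | no _  = trans (+-suc (count P? xs) _) (cong suc (count-complement P? xs))

count-filter : {P R : A → Set} (P? : Decidable P) (R? : Decidable R) → ∀ xs → count P? (filter R? xs) ≤ count P? xs
count-filter P? R? [] = z≤n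
count-filter P? R? (x ∷ xs) with R? x
... | no _ with P? x
...   | yes _ = m≤n⇒m≤1+n (count-filter P? R? xs)
...   | no _  = count-filter P? R? xs
count-filter P? R? (x ∷ xs) | yes _ with P? x
...   | yes _ = s≤s (count-filter P? R? xs)
...   | no _  = count-filter P? R? xs

count-mono : {P Q : A → Set} (P? : Decidable P) (Q? : Decidable Q) → (∀ x → P x → Q x) →
             ∀ xs → count P? xs ≤ count Q? xs
count-mono P? Q? P⊆Q [] = z≤n
count-mono P? Q? P⊆Q (x ∷ xs) with P? x | Q? x
... | yes _ | yes _ = s≤s (count-mono P? Q? P⊆Q xs)
... | yes p | no ¬q = contradiction (P⊆Q x p) ¬q
... | no _  | yes _ = m≤n⇒m≤1+n (count-mono P? Q? P⊆Q xs)
... | no _  | no _  = count-mono P? Q? P⊆Q xs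

count-strict : {P Q : A → Set} (P? : Decidable P) (Q? : Decidable Q) → (∀ x → P x → Q x) →
               ∀ {xs y} → y ∈ xs → Q y → ¬ P y → count P? xs < count Q? xs
count-strict P? Q? P⊆Q {x ∷ xs} (here refl) q ¬p with P? x | Q? x
... | yes p | _     = contradiction p ¬p
... | no _  | no ¬q = contradiction q ¬q
... | no _  | yes _ = s≤s (count-mono P? Q? P⊆Q xs)
count-strict P? Q? P⊆Q {x ∷ xs} (there y∈) q ¬p with P? x | Q? x
... | yes _ | yes _ = s≤s (count-strict P? Q? P⊆Q y∈ q ¬p)
... | yes p | no ¬q = contradiction (P⊆Q x p) ¬q
... | no _  | yes _ = m≤n⇒m≤1+n (count-strict P? Q? P⊆Q y∈ q ¬p)
... | no _  | no _  = count-strict P? Q? P⊆Q y∈ q ¬p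

-- The union bound, by repeated use of `count-∪`.
count-Any : {P : B → A → Set} (P? : ∀ y x → Dec (P y x)) → ∀ ys xs {M} → (∀ {y} → y ∈ ys → count (P? y) xs ≤ M) →
            count (λ x → any? (λ y → P? y x) ys) xs ≤ length ys * M
count-Any P? [] xs bound = ≤-reflexive (nothing-satisfies xs)
  where
    nothing-satisfies : ∀ xs → count (λ x → any? (λ y → P? y x) []) xs ≡ 0
    nothing-satisfies []       = refl
    nothing-satisfies (x ∷ xs) = nothing-satisfies xs
count-Any {P = P} P? (y ∷ ys) xs bound =
  ≤-trans (count-∪ (P? y) (λ x → any? (λ y → P? y x) ys) (λ x → any? (λ y → P? y x) (y ∷ ys)) uncons xs)
          (+-mono-≤ (bound (here refl)) (count-Any P? ys xs (bound ∘ there)))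
  where
    uncons : ∀ x → Any (λ y → P y x) (y ∷ ys) → P y x ⊎ Any (λ y → P y x) ys
    uncons x (here p)  = inj₁ p
    uncons x (there a) = inj₂ a

-- Pigeonhole by induction on `q`: if the top value is not popular, discarding its at most `D`
-- occurrences leaves more than `q * D` entries with smaller values.
popular-value : ∀ q (f : A → ℕ) {D} xs → (∀ {x} → x ∈ xs → f x < q) → q * D < length xs →
                ∃ λ c → D < count (λ x → f x ≟ c) xs
popular-value zero    f (x ∷ xs) f<q _ with () ← f<q (here refl)
popular-value (suc q) f {D} xs f<q big with D <? count (λ x → f x ≟ q) xs
... | yes popular = q , popular
... | no ¬popular with popular-value q f (filter (λ x → ¬? (f x ≟ q)) xs) rest<q rest-big
  where
    rest<q : ∀ {x} → x ∈ filter (λ x → ¬? (f x ≟ q)) xs → f x < q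
    rest<q x∈ with ∈-filter⁻ (λ x → ¬? (f x ≟ q)) {xs = xs} x∈
    ... | x∈xs , fx≢q = ≤∧≢⇒< (≤-pred (f<q x∈xs)) fx≢q
    rest-big : q * D < count (λ x → ¬? (f x ≟ q)) xs
    rest-big = +-cancelˡ-< D _ _ (<-≤-trans big (≤-trans
      (≤-reflexive (sym (count-complement (λ x → f x ≟ q) xs)))
      (+-monoˡ-≤ _ (≮⇒≥ ¬popular))))
... | c , popular = c , <-≤-trans popular (count-filter (λ x → f x ≟ c) (λ x → ¬? (f x ≟ q)) xs)

-- Both sides are compared with the number of related pairs: `total` sums it by rows, and
-- `total-cons` peels off one column.
double-counting : {R : A → B → Set} (R? : ∀ x y → Dec (R x y)) → ∀ xs ys {M m} →
  (∀ {y} → y ∈ ys → count (λ x → R? x y) xs ≤ M) → (∀ {x} → x ∈ xs → m ≤ count (R? x) ys) →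
  length xs * m ≤ length ys * M
double-counting {A = A} {B = B} R? xs ys upper lower = ≤-trans (total-lower xs lower) (total-upper ys upper)
  where
    total : List A → List B → ℕ
    total xs ys = sum (map (λ x → count (R? x) ys) xs)

    total-lower : ∀ xs {m} → (∀ {x} → x ∈ xs → m ≤ count (R? x) ys) → length xs * m ≤ total xs ys
    total-lower []       lower = z≤n
    total-lower (x ∷ xs) lower = +-mono-≤ (lower (here refl)) (total-lower xs (lower ∘ there))

    total-cons : ∀ xs y ys → total xs (y ∷ ys) ≡ count (λ x → R? x y) xs + total xs ys
    total-cons []       y ys = refl
    total-cons (x ∷ xs) y ys with R? x y
    ... | yes _ = cong suc (trans (cong (count (R? x) ys +_) (total-cons xs y ys))
                    (x∙yz≈y∙xz +-commutativeSemigroup (count (R? x) ys) (count (λ x → R? x y) xs) _))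
    ... | no _  = trans (cong (count (R? x) ys +_) (total-cons xs y ys))
                    (x∙yz≈y∙xz +-commutativeSemigroup (count (R? x) ys) (count (λ x → R? x y) xs) _)

    total-nil : ∀ xs → total xs [] ≡ 0
    total-nil []       = refl
    total-nil (x ∷ xs) = total-nil xs

    total-upper : ∀ ys {M} → (∀ {y} → y ∈ ys → count (λ x → R? x y) xs ≤ M) → total xs ys ≤ length ys * M
    total-upper []       upper = ≤-reflexive (total-nil xs)
    total-upper (y ∷ ys) upper = ≤-trans (≤-reflexive (total-cons xs y ys))
      (+-mono-≤ (upper (here refl)) (total-upper ys (upper ∘ there)))

-- Prefixes, suffixes and sorted lists

count-++ : {P : A → Set} (P? : Decidable P) → ∀ xs ys → count P? (xs ++ ys) ≡ count P? xs + count P? ys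
count-++ P? []       ys = refl
count-++ P? (x ∷ xs) ys with P? x
... | yes _ = cong suc (count-++ P? xs ys)
... | no _  = count-++ P? xs ys

count-take : {P : A → Set} (P? : Decidable P) → ∀ n xs → count P? (take n xs) ≤ count P? xs
count-take P? n xs = ≤-trans (m≤m+n _ (count P? (drop n xs)))
  (≤-reflexive (trans (sym (count-++ P? (take n xs) (drop n xs))) (cong (count P?) (take++drop≡id n xs))))

count-drop : {P : A → Set} (P? : Decidable P) → ∀ n xs → count P? (drop n xs) ≤ count P? xs
count-drop P? n xs = ≤-trans (m≤n+m _ (count P? (take n xs)))
  (≤-reflexive (trans (sym (count-++ P? (take n xs) (drop n xs))) (cong (count P?) (take++drop≡id n xs))))

∈-take⁻ : ∀ n (xs : List A) {x} → x ∈ take n xs → x ∈ xs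
∈-take⁻ n xs x∈ = subst (_ ∈_) (take++drop≡id n xs) (∈-++⁺ˡ x∈)

∈-drop⁻ : ∀ n (xs : List A) {x} → x ∈ drop n xs → x ∈ xs
∈-drop⁻ n xs x∈ = subst (_ ∈_) (take++drop≡id n xs) (∈-++⁺ʳ (take n xs) x∈)

take-drop-related : ∀ {R : A → A → Set} n {xs x y} → AllPairs R xs → x ∈ take n xs → y ∈ drop n xs → R x y
take-drop-related (suc n) (Rx ∷ Rxs) (here refl) y∈ = All.lookup Rx (∈-drop⁻ n _ y∈)
take-drop-related (suc n) (Rx ∷ Rxs) (there x∈) y∈  = take-drop-related n Rxs x∈ y∈

member : ∀ (xs : List A) → 0 < length xs → ∃ (_∈ xs)
member (x ∷ xs) _ = x , here refl

AllPairs-lookup : ∀ {R : A → A → Set} {xs : List A} → AllPairs R xs → ∀ {i j} → i Fin.< j → R (lookup xs i) (lookup xs j)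
AllPairs-lookup (Rx ∷ Rxs) {Fin.zero}  {Fin.suc j} _         = All.lookup Rx (∈-lookup j)
AllPairs-lookup (Rx ∷ Rxs) {Fin.suc i} {Fin.suc j} (s≤s i<j) = AllPairs-lookup Rxs i<j

-- Greedy choice of a long sequence without bad triples

module Sampling
  {Bad : ℕ → ℕ → ℕ → Set} (bad? : ∀ v x w → Dec (Bad v x w))
  (bad-ordered : ∀ {v x w} → Bad v x w → v < x × x < w)
  (B L b : ℕ) (b>0 : 0 < b) (room : (L * (b + b)) * (L * B) ≤ b * b) (Y : List ℕ)
  where

  -- State of the greedy choice: `S` is chosen, largest vertex first, and `Z` holds the candidates
  -- above it. `extendable` makes every candidate safe to add to `S`; `sparse` passes to sublists of
  -- `Z`.
  record Partial (S Z : List ℕ) : Set where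
    field
      descending : AllPairs (λ x y → y < x) S
      chosen     : ∀ {x} → x ∈ S → x ∈ Y
      increasing : AllPairs _<_ Z
      candidate  : ∀ {x} → x ∈ Z → x ∈ Y
      separated  : ∀ {x z} → x ∈ S → z ∈ Z → x < z
      good       : ∀ {v x w} → v ∈ S → x ∈ S → w ∈ S → ¬ Bad v x w
      extendable : ∀ {v x w} → v ∈ S → x ∈ S → w ∈ Z → ¬ Bad v x w
      sparse     : ∀ {v w} → v ∈ Y → w ∈ Y → count (λ x → bad? v x w) Z ≤ B

  blocked? : ∀ S x w → Dec (Any (λ v → Bad v x w) S)
  blocked? S x w = any? (λ v → bad? v x w) S

  survivors : List ℕ → ℕ → List ℕ → List ℕ
  survivors S x Z = filter (λ w → ¬? (blocked? S x w)) (drop b Z)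

  -- Averaging: if every `x` in the first block blocked more than `b` later candidates, there would
  -- be at least `b * suc b` blocked pairs. But each later `w` is blocked by at most `L * B` of
  -- these `x`, and `room` caps the total at `b * b`.
  choose : ∀ {S Z} → Partial S Z → length S ≤ L → length Z ≤ L * (b + b) → b ≤ length Z →
           ∃ λ x → x ∈ take b Z × count (blocked? S x) (drop b Z) ≤ b
  choose {S} {Z} st |S|≤L |Z|≤ b≤|Z|
    with any? (λ x → count (blocked? S x) (drop b Z) ≤? b) (take b Z)
  ... | yes found = find found
  ... | no ¬found = contradiction (≤-trans overcount room) (<⇒≱ (*-monoʳ-< b {{>-nonZero b>0}} (n<1+n b)))
    where
      open Partial st
      |take| : length (take b Z) ≡ b
      |take| = trans (length-take b Z) (m≤n⇒m⊓n≡m b≤|Z|)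

      sparse-take : ∀ {v w} → v ∈ Y → w ∈ Y → count (λ x → bad? v x w) (take b Z) ≤ B
      sparse-take v∈ w∈ = ≤-trans (count-take _ b Z) (sparse v∈ w∈)

      few : ∀ {w} → w ∈ drop b Z → count (λ x → blocked? S x w) (take b Z) ≤ L * B
      few w∈ = ≤-trans (count-Any (λ v x → bad? v x _) S (take b Z)
                         (λ v∈ → sparse-take (chosen v∈) (candidate (∈-drop⁻ b Z w∈))))
                       (*-monoˡ-≤ B |S|≤L)

      overcount : b * suc b ≤ (L * (b + b)) * (L * B)
      overcount = ≤-trans
        (≤-trans (≤-reflexive (cong (_* suc b) (sym |take|)))
          (double-counting (blocked? S) (take b Z) (drop b Z) few
            (λ x∈ → ≰⇒> (λ ok → ¬found (lose x∈ ok)))))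
        (*-monoˡ-≤ (L * B) (≤-trans (≤-reflexive (length-drop b Z)) (≤-trans (m∸n≤m (length Z) b) |Z|≤)))

  advance : ∀ {S Z x} → Partial S Z → x ∈ take b Z → Partial (x ∷ S) (survivors S x Z)
  advance {S} {Z} {x} st x∈take = record
    { descending = All.tabulate (λ y∈ → separated y∈ x∈Z) ∷ descending
    ; chosen     = λ { (here refl) → candidate x∈Z ; (there y∈) → chosen y∈ }
    ; increasing = AllPairs.filter⁺ _ (AllPairs.drop⁺ b increasing)
    ; candidate  = candidate ∘ later
    ; separated  = λ { (here refl) z∈ → x<later z∈ ; (there y∈) z∈ → separated y∈ (later z∈) }
    ; good       = good′
    ; extendable = extendable′
    ; sparse     = λ v∈ w∈ → ≤-trans (count-filter _ _ (drop b Z)) (≤-trans (count-drop _ b Z) (sparse v∈ w∈))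
    }
    where
      open Partial st
      x∈Z : x ∈ Z
      x∈Z = ∈-take⁻ b Z x∈take

      unfilter : ∀ {z} → z ∈ survivors S x Z → z ∈ drop b Z × ¬ Any (λ v → Bad v x z) S
      unfilter = ∈-filter⁻ (λ w → ¬? (blocked? S x w)) {xs = drop b Z}

      later : ∀ {z} → z ∈ survivors S x Z → z ∈ Z
      later z∈ = ∈-drop⁻ b Z (proj₁ (unfilter z∈))

      x<later : ∀ {z} → z ∈ survivors S x Z → x < z
      x<later z∈ = take-drop-related b increasing x∈take (proj₁ (unfilter z∈))

      not-above : ∀ {y} → y ∈ x ∷ S → ¬ x < y
      not-above (here refl) x<x = <-irrefl refl x<x
      not-above (there y∈)  x<y = <-asym x<y (separated y∈ x∈Z)

      -- As `x` exceeds all of `S`, it can only be the last vertex of a bad triple, a case that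
      -- `extendable` rules out.
      good′ : ∀ {v y w} → v ∈ x ∷ S → y ∈ x ∷ S → w ∈ x ∷ S → ¬ Bad v y w
      good′ (here refl) y∈          w∈          bad = not-above y∈ (proj₁ (bad-ordered bad))
      good′ (there v∈)  (here refl) w∈          bad = not-above w∈ (proj₂ (bad-ordered bad))
      good′ (there v∈)  (there y∈)  (here refl) bad = extendable v∈ y∈ x∈Z bad
      good′ (there v∈)  (there y∈)  (there w∈)  bad = good v∈ y∈ w∈ bad

      extendable′ : ∀ {v y w} → v ∈ x ∷ S → y ∈ x ∷ S → w ∈ survivors S x Z → ¬ Bad v y w
      extendable′ (here refl) y∈          w∈ bad = not-above y∈ (proj₁ (bad-ordered bad))
      extendable′ (there v∈)  (here refl) w∈ bad = proj₂ (unfilter w∈) (lose v∈ bad)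
      extendable′ (there v∈)  (there y∈)  w∈ bad = extendable v∈ y∈ (later w∈) bad

  -- Each choice costs at most `b + b` candidates: the block from which `x` is taken, and at most
  -- `b` candidates that `x` blocks.
  sample : ∀ l {S Z} → Partial S Z → length S + l ≤ L → l * (b + b) ≤ length Z → length Z ≤ L * (b + b) →
           ∃ λ T → length T ≡ length S + l × AllPairs (λ x y → y < x) T ×
                   (∀ {v x w} → v ∈ T → x ∈ T → w ∈ T → ¬ Bad v x w)
  sample zero {S} st _ _ _ = S , sym (+-identityʳ _) , Partial.descending st , Partial.good st
  sample (suc l) {S} {Z} st S+l≤L enough |Z|≤
    with choose st (≤-trans (m≤m+n _ _) S+l≤L) |Z|≤ (≤-trans (m≤m+n b _) (≤-trans (m≤m+n (b + b) _) enough))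
  ... | x , x∈ , few with sample l (advance st x∈) (≤-trans (≤-reflexive (sym (+-suc (length S) l))) S+l≤L)
                            enough′ |Z′|≤
    where
      |drop| : length (drop b Z) ≤ L * (b + b)
      |drop| = ≤-trans (≤-reflexive (length-drop b Z)) (≤-trans (m∸n≤m (length Z) b) |Z|≤)

      |Z′|≤ : length (survivors S x Z) ≤ L * (b + b)
      |Z′|≤ = ≤-trans (length-filter _ (drop b Z)) |drop|

      enough′ : l * (b + b) ≤ length (survivors S x Z)
      enough′ = +-cancelˡ-≤ b _ _ (≤-trans
        (+-cancelˡ-≤ b _ _ (≤-trans (≤-reflexive (sym (+-assoc b b _))) (≤-trans enough (≤-trans
          (m≤n+m∸n (length Z) b) (+-monoʳ-≤ b (≤-reflexive (sym (length-drop b Z))))))))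
        (≤-trans (≤-reflexive (sym (count-complement (blocked? S x) (drop b Z)))) (+-monoˡ-≤ _ few)))
  ... | T , |T| , desc , good = T , trans |T| (sym (+-suc (length S) l)) , desc , good

-- Bands of colours and their splitting

-- The colours c with lo ≤ c < hi, in which sets of size suc rank are sought.
record Band : Set where
  constructor band
  field
    lo hi rank : ℕ

open Band

Inside : ℕ → Band → Set
Inside c I = lo I ≤ c × c < hi I

inside? : ∀ c I → Dec (Inside c I)
inside? c I = (lo I ≤? c) ×-dec (c <? hi I)

low-part high-part : ℕ → Band → Band
low-part  c I = band (lo I) (suc c) (pred (rank I))
high-part c I = band (suc c) (hi I) (pred (rank I))

-- The band to cut is marked by an `Any` witness, so that the common band found in a bad triple
-- serves directly as the position.
split : {P : Band → Set} {Is : List Band} → Any P Is → ℕ → List Band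
split {Is = I ∷ Is} (here _)  c = low-part c I ∷ high-part c I ∷ Is
split {Is = I ∷ Is} (there p) c = I ∷ split p c

weight : List Band → ℕ
weight []       = 0
weight (I ∷ Is) = 2 ^ rank I + weight Is

length≤weight : ∀ Is → length Is ≤ weight Is
length≤weight []       = z≤n
length≤weight (I ∷ Is) = +-mono-≤ (m^n>0 2 (rank I)) (length≤weight Is)

length-split : {P : Band → Set} {Is : List Band} (p : Any P Is) (c : ℕ) → length (split p c) ≡ suc (length Is)
length-split (here _)  c = refl
length-split (there p) c = cong suc (length-split p c)

-- Two halves `2 ^ r` replace `2 ^ suc r`. At rank 0 `pred` would change nothing and the weight
-- would grow, so this case is excluded.
weight-split : {P : Band → Set} {Is : List Band} → All (λ I → rank I ≢ 0) Is → (p : Any P Is) (c : ℕ) →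
               weight (split p c) ≡ weight Is
weight-split {Is = band _ _ zero ∷ Is} (r≢0 ∷ _) (here _) c = contradiction refl r≢0
weight-split {Is = band _ _ (suc r) ∷ Is} _ (here _) c =
  trans (sym (+-assoc (2 ^ r) (2 ^ r) _)) (cong (λ m → 2 ^ r + m + weight Is) (sym (+-identityʳ (2 ^ r))))
weight-split {Is = I ∷ _} (_ ∷ r≢0) (there p) c = cong (2 ^ rank I +_) (weight-split r≢0 p c)

Inside-split : {P : Band → Set} {Is : List Band} (p : Any P Is) (c : ℕ) {e : ℕ} →
               Any (Inside e) Is → Any (Inside e) (split p c)
Inside-split (here _) c {e} (here (lo≤e , e<hi)) with e ≤? c
... | yes e≤c = here (lo≤e , s≤s e≤c)
... | no  e≰c = there (here (≰⇒> e≰c , e<hi))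
Inside-split (here _)  c (there a) = there (there a)
Inside-split (there p) c (here i)  = here i
Inside-split (there p) c (there a) = there (Inside-split p c a)

-- Number of vertices needed for a given number of splits

module Threshold (q L : ℕ) where

  -- Colours below q are in play and L exceeds the number of possible peak vectors.  More than middles m bad
  -- vertices between v and w yield threshold m of them with the same pair of colours to v and w.
  middles block threshold : ℕ → ℕ
  middles m = q * (q * threshold m)
  block m = 2 * (L * L * middles m)
  threshold zero    = 1
  threshold (suc m) = L * (block m + block m)

  module _ (q>0 : 0 < q) (L>0 : 0 < L) where

    block>0     : ∀ m → 0 < block m
    threshold>0 : ∀ m → 0 < threshold m
    block>0 m = *-mono-< {0} {2} {0} (s≤s z≤n) (*-mono-< {0} (*-mono-< {0} L>0 L>0)
      (*-mono-< {0} q>0 (*-mono-< {0} q>0 (threshold>0 m))))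
    threshold>0 zero    = s≤s z≤n
    threshold>0 (suc m) = *-mono-< {0} L>0 (<-≤-trans (block>0 m) (m≤m+n (block m) (block m)))

  -- One step of the recursion multiplies the threshold by `4 * L ^ 3 * q ^ 2`, which costs
  -- `2 + 3 * l + 2 * t` bits.
  threshold≤2^ : ∀ l t → L ≤ 2 ^ l → q ≤ 2 ^ t → ∀ m → threshold m ≤ 2 ^ ((2 + (l + l + l) + (t + t)) * m)
  threshold≤2^ l t L≤ q≤ zero = m^n>0 2 ((2 + (l + l + l) + (t + t)) * 0)
  threshold≤2^ l t L≤ q≤ (suc m) = begin
    L * (block m + block m)                          ≡⟨ shape L q (threshold m) ⟩
    (4 * (L * L * L) * (q * q)) * threshold m        ≤⟨ *-mono-≤ (*-mono-≤ (*-monoʳ-≤ 4 (*-mono-≤ (*-mono-≤ L≤ L≤) L≤))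
                                                                  (*-mono-≤ q≤ q≤)) (threshold≤2^ l t L≤ q≤ m) ⟩
    (4 * (2 ^ l * 2 ^ l * 2 ^ l) * (2 ^ t * 2 ^ t)) * 2 ^ (e * m)  ≡⟨ cong (_* 2 ^ (e * m)) powers ⟨
    2 ^ e * 2 ^ (e * m)                              ≡⟨ ^-distribˡ-+-* 2 e (e * m) ⟨
    2 ^ (e + e * m)                                  ≡⟨ cong (2 ^_) (*-suc e m) ⟨
    2 ^ (e * suc m)                                  ∎
    where
      open ≤-Reasoning
      e : ℕ
      e = 2 + (l + l + l) + (t + t)
      shape : ∀ L q T → L * (2 * (L * L * (q * (q * T))) + 2 * (L * L * (q * (q * T)))) ≡ (4 * (L * L * L) * (q * q)) * T
      shape = solve 3 (λ L q T → L :* (con 2 :* (L :* L :* (q :* (q :* T))) :+ con 2 :* (L :* L :* (q :* (q :* T))))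
                := (con 4 :* (L :* L :* L) :* (q :* q)) :* T) refl
        where open +-*-Solver
      powers : 2 ^ e ≡ 4 * (2 ^ l * 2 ^ l * 2 ^ l) * (2 ^ t * 2 ^ t)
      powers = trans (^-distribˡ-+-* 2 (2 + (l + l + l)) (t + t))
        (cong₂ _*_ (trans (^-distribˡ-+-* 2 2 (l + l + l)) (cong (4 *_)
                     (trans (^-distribˡ-+-* 2 (l + l) l) (cong (_* 2 ^ l) (^-distribˡ-+-* 2 l l)))))
                   (^-distribˡ-+-* 2 t t))

-- Non-increasing sets in a band and their extension

module _ (χ : ℕ → ℕ → ℕ) where

  Triple : ℕ → ℕ → ℕ → Set
  Triple u v w = (χ u v ≡ χ u w × χ v w ≤ χ u v) ⊎ (χ v w ≤ χ u v × χ v w ≡ χ u w)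

  record NonIncreasing (Y : List ℕ) (I : Band) : Set where
    field
      members : List ℕ
      sorted  : AllPairs _<_ members
      within  : ∀ {x} → x ∈ members → x ∈ Y
      size    : length members ≡ suc (rank I)
      colours : ∀ {u v} → u ∈ members → v ∈ members → u < v → Inside (χ u v) I
      triples : ∀ {u v w} → u ∈ members → v ∈ members → w ∈ members → u < v → v < w → Triple u v w

  widen : ∀ {X Y I} → (∀ {x} → x ∈ X → x ∈ Y) → NonIncreasing X I → NonIncreasing Y I
  widen X⊆Y F = record
    { members = members ; sorted = sorted ; within = X⊆Y ∘ within ; size = size ; colours = colours ; triples = triples }
    where open NonIncreasing F

  singleton : ∀ {Y I y} → y ∈ Y → rank I ≡ 0 → NonIncreasing Y I
  singleton {y = y} y∈Y r≡0 = record
    { members = y ∷ []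
    ; sorted  = [] ∷ []
    ; within  = λ { (here refl) → y∈Y }
    ; size    = cong suc (sym r≡0)
    ; colours = λ { (here refl) (here refl) y<y → contradiction y<y (<-irrefl refl) }
    ; triples = λ { (here refl) (here refl) _ y<y → contradiction y<y (<-irrefl refl) }
    }

  module Extension {Y X : List ℕ} {v w c d : ℕ} (v∈Y : v ∈ Y) (w∈Y : w ∈ Y)
    (X⊆Y : ∀ {x} → x ∈ X → x ∈ Y) (v<X : ∀ {x} → x ∈ X → v < x) (X<w : ∀ {x} → x ∈ X → x < w)
    (vX : ∀ {x} → x ∈ X → χ v x ≡ d) (Xw : ∀ {x} → x ∈ X → χ x w ≡ c) (c≤d : c ≤ d) where

    -- Colours in the set are at most `c ≤ d`, and `v` has the one colour `d` to it, so triples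
    -- starting at `v` satisfy the first clause of `Triple`.
    prepend : ∀ {I} → rank I ≢ 0 → Inside d I → Inside c I → NonIncreasing X (low-part c I) → NonIncreasing Y I
    prepend {I} r≢0 d∈I c∈I F = record
      { members = v ∷ members
      ; sorted  = All.tabulate (v<X ∘ within) ∷ sorted
      ; within  = λ { (here refl) → v∈Y ; (there x∈) → X⊆Y (within x∈) }
      ; size    = cong suc (trans size (suc-pred (rank I) {{≢-nonZero r≢0}}))
      ; colours = colours′
      ; triples = triples′
      }
      where
        open NonIncreasing F
        ¬below : ∀ {x} → x ∈ v ∷ members → ¬ x < v
        ¬below (here refl) = <-irrefl refl
        ¬below (there x∈)  = <-asym (v<X (within x∈))

        colours′ : ∀ {x y} → x ∈ v ∷ members → y ∈ v ∷ members → x < y → Inside (χ x y) I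
        colours′ x∈ (here refl) x<v = contradiction x<v (¬below x∈)
        colours′ (here refl) (there y∈) _ = subst (λ e → Inside e I) (sym (vX (within y∈))) d∈I
        colours′ (there x∈) (there y∈) x<y with colours x∈ y∈ x<y
        ... | lo≤ , <c = lo≤ , <-≤-trans <c (proj₂ c∈I)

        triples′ : ∀ {x y z} → x ∈ v ∷ members → y ∈ v ∷ members → z ∈ v ∷ members → x < y → y < z → Triple x y z
        triples′ x∈ (here refl) z∈ x<v _ = contradiction x<v (¬below x∈)
        triples′ x∈ (there y∈) (here refl) _ y<v = contradiction y<v (¬below (there y∈))
        triples′ (there x∈) (there y∈) (there z∈) = triples x∈ y∈ z∈
        triples′ (here refl) (there y∈) (there z∈) _ y<z = inj₁
          ( trans (vX (within y∈)) (sym (vX (within z∈)))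
          , ≤-trans (≤-pred (proj₂ (colours y∈ z∈ y<z))) (≤-trans c≤d (≤-reflexive (sym (vX (within y∈))))))

    -- Colours in the set exceed `c`, the one colour from it to `w`, so triples ending at `w`
    -- satisfy the second clause.
    append : ∀ {I} → rank I ≢ 0 → Inside c I → NonIncreasing X (high-part c I) → NonIncreasing Y I
    append {I} r≢0 c∈I F = record
      { members = members ++ w ∷ []
      ; sorted  = AllPairs.++⁺ sorted ([] ∷ []) (All.tabulate (λ x∈ → X<w (within x∈) ∷ []))
      ; within  = λ x∈ → within′ (∈-++⁻ members x∈)
      ; size    = trans (length-++ members) (trans (+-comm (length members) 1)
                    (cong suc (trans size (suc-pred (rank I) {{≢-nonZero r≢0}}))))
      ; colours = λ x∈ y∈ → colours′ (∈-++⁻ members x∈) (∈-++⁻ members y∈)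
      ; triples = λ x∈ y∈ z∈ → triples′ (∈-++⁻ members x∈) (∈-++⁻ members y∈) (∈-++⁻ members z∈)
      }
      where
        open NonIncreasing F
        Member : ℕ → Set
        Member x = x ∈ members ⊎ x ∈ w ∷ []

        within′ : ∀ {x} → Member x → x ∈ Y
        within′ (inj₁ x∈)          = X⊆Y (within x∈)
        within′ (inj₂ (here refl)) = w∈Y

        ¬above : ∀ {x} → Member x → ¬ w < x
        ¬above (inj₁ x∈)          = <-asym (X<w (within x∈))
        ¬above (inj₂ (here refl)) = <-irrefl refl

        colours′ : ∀ {x y} → Member x → Member y → x < y → Inside (χ x y) I
        colours′ (inj₂ (here refl)) y∈ w<y = contradiction w<y (¬above y∈)
        colours′ (inj₁ x∈) (inj₂ (here refl)) _ = subst (λ e → Inside e I) (sym (Xw (within x∈))) c∈I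
        colours′ (inj₁ x∈) (inj₁ y∈) x<y with colours x∈ y∈ x<y
        ... | c< , <hi = ≤-trans (proj₁ c∈I) (<⇒≤ c<) , <hi

        triples′ : ∀ {x y z} → Member x → Member y → Member z → x < y → y < z → Triple x y z
        triples′ (inj₂ (here refl)) y∈ _ w<y _ = contradiction w<y (¬above y∈)
        triples′ (inj₁ _) (inj₂ (here refl)) z∈ _ w<z = contradiction w<z (¬above z∈)
        triples′ (inj₁ x∈) (inj₁ y∈) (inj₁ z∈) = triples x∈ y∈ z∈
        triples′ (inj₁ x∈) (inj₁ y∈) (inj₂ (here refl)) x<y _ = inj₂
          ( ≤-trans (≤-reflexive (Xw (within y∈))) (<⇒≤ (proj₁ (colours x∈ y∈ x<y)))
          , trans (Xw (within y∈)) (sym (Xw (within x∈))))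

    -- The vertex added in either half makes up for the rank lost in the split; in all other bands
    -- the set is kept.
    unsplit : ∀ {Is} → All (λ I → rank I ≢ 0) Is → (p : Any (λ I → Inside d I × Inside c I) Is) →
              Any (NonIncreasing X) (split p c) → Any (NonIncreasing Y) Is
    unsplit (r≢0 ∷ _) (here (d∈I , c∈I)) (here F)          = here (prepend r≢0 d∈I c∈I F)
    unsplit (r≢0 ∷ _) (here (d∈I , c∈I)) (there (here F))  = here (append r≢0 c∈I F)
    unsplit _         (here _)           (there (there a)) = there (Any.map (widen X⊆Y) a)
    unsplit _         (there p)          (here F)          = here (widen X⊆Y F)
    unsplit (_ ∷ r≢0) (there p)          (there a)         = there (unsplit r≢0 p a)

  -- Bad triples and peak labels

  Bad : List Band → ℕ → ℕ → ℕ → Set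
  Bad Is v x w = (v < x × x < w) × (χ x w ≤ χ v x × Any (λ I → Inside (χ v x) I × Inside (χ x w) I) Is)

  bad? : ∀ Is v x w → Dec (Bad Is v x w)
  bad? Is v x w = ((v <? x) ×-dec (x <? w)) ×-dec
    ((χ x w ≤? χ v x) ×-dec any? (λ I → inside? (χ v x) I ×-dec inside? (χ x w) I) Is)

  -- One more than the largest colour in `I` on a pair ending at `x`. The shift leaves 0 for the
  -- absence of such a pair, so colours below `q` give `suc q` possible labels.
  peak : Band → List ℕ → ℕ → ℕ
  peak I []      x = 0
  peak I (u ∷ S) x with (u <? x) ×-dec inside? (χ u x) I
  ... | yes _ = suc (χ u x) ⊔ peak I S x
  ... | no _  = peak I S x

  peak-least : ∀ I S x {m} → (∀ {u} → u ∈ S → u < x → Inside (χ u x) I → χ u x < m) → peak I S x ≤ m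
  peak-least I []      x bound = z≤n
  peak-least I (u ∷ S) x bound with (u <? x) ×-dec inside? (χ u x) I
  ... | yes (u<x , i) = ⊔-lub (bound (here refl) u<x i) (peak-least I S x (bound ∘ there))
  ... | no _          = peak-least I S x (bound ∘ there)

  peak-upper : ∀ I S x {u} → u ∈ S → u < x → Inside (χ u x) I → χ u x < peak I S x
  peak-upper I (u ∷ S) x (here refl) u<x i with (u <? x) ×-dec inside? (χ u x) I
  ... | yes _ = m≤m⊔n _ (peak I S x)
  ... | no ¬p = contradiction (u<x , i) ¬p
  peak-upper I (u′ ∷ S) x (there u∈) u<x i with (u′ <? x) ×-dec inside? (χ u′ x) I
  ... | yes _ = ≤-trans (peak-upper I S x u∈ u<x i) (m≤n⊔m (suc (χ u′ x)) _)
  ... | no _  = peak-upper I S x u∈ u<x i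

  module _ (q : ℕ) (χ<q : ∀ u v → χ u v < q) where

    -- Pigeonhole on the vectors of peaks, one entry per band: two vertices with equal vectors are
    -- impossible in the band of the colour between them.
    bad-free-short : ∀ Is → (∀ {e} → e < q → Any (Inside e) Is) → ∀ S → AllPairs (λ x y → y < x) S →
      (∀ {v x w} → v ∈ S → x ∈ S → w ∈ S → ¬ Bad Is v x w) → length S ≤ suc q ^ length Is
    bad-free-short Is covers S descending good = ≮⇒≥ (λ long → collision (Fin.pigeonhole long (funToFin ∘ peaks)))
      where
        peaks : Fin (length S) → Fin (length Is) → Fin (suc q)
        peaks i k = fromℕ< (s≤s (peak-least (lookup Is k) S (lookup S i) (λ _ _ _ → χ<q _ _)))

        toℕ-peaks : ∀ i k → toℕ (peaks i k) ≡ peak (lookup Is k) S (lookup S i)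
        toℕ-peaks i k = Fin.toℕ-fromℕ< _

        peaks-injective : ∀ i j k → funToFin (peaks i) ≡ funToFin (peaks j) → peaks i k ≡ peaks j k
        peaks-injective i j k same = trans (sym (Fin.finToFun-funToFin (peaks i) k))
          (trans (cong (λ l → finToFun l k) same) (Fin.finToFun-funToFin (peaks j) k))

        collision : ¬ (∃₂ λ i j → i Fin.< j × funToFin (peaks i) ≡ funToFin (peaks j))
        collision (i , j , i<j , same) = <-irrefl refl (begin-strict
          χ u x                       <⟨ peak-upper I S x (∈-lookup j) u<x inside ⟩
          peak I S x                  ≡⟨ toℕ-peaks i k ⟨
          toℕ (peaks i k)             ≡⟨ cong toℕ (peaks-injective i j k same) ⟩
          toℕ (peaks j k)             ≡⟨ toℕ-peaks j k ⟩
          peak I S u                  ≤⟨ peak-least I S u below ⟩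
          χ u x                       ∎)
          where
            open ≤-Reasoning
            -- `S` is descending, so the later index `j` gives the smaller vertex.
            x u : ℕ
            x = lookup S i
            u = lookup S j
            u<x : u < x
            u<x = AllPairs-lookup descending i<j
            cover : Any (Inside (χ u x)) Is
            cover = covers (χ<q u x)
            k : Fin (length Is)
            k = Any.index cover
            I : Band
            I = lookup Is k
            inside : Inside (χ u x) I
            inside = lookup-index cover
            -- A pair `t < u` in the same band with colour at least `χ u x` would make `t`, `u`, `x`
            -- a bad triple.
            below : ∀ {t} → t ∈ S → t < u → Inside (χ t u) I → χ t u < χ u x
            below t∈ t<u inside′ = ≰⇒> (λ ux≤tu → good t∈ (∈-lookup j) (∈-lookup i)
              ((t<u , u<x) , ux≤tu , lose (∈-lookup k) (inside′ , inside)))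

    -- Induction on the number of remaining splits

    module _ (q>0 : 0 < q) (K L : ℕ) (L-large : suc q ^ K < L) where
      open Threshold q L

      L>0 : 0 < L
      L>0 = ≤-<-trans z≤n L-large

      -- A split lengthens `Is` by one, lowers `m` by one and keeps the weight, so the hypotheses
      -- persist. At `m = 0` there would be more than `K` bands, each of weight at least 1.
      forced : ∀ m Is → weight Is ≤ K → K < length Is + m → (∀ {e} → e < q → Any (Inside e) Is) →
               ∀ Y → AllPairs _<_ Y → threshold m ≤ length Y → Any (NonIncreasing Y) Is
      forced zero Is weight≤K K< _ _ _ _ = contradiction
        (<-≤-trans K< (≤-trans (≤-reflexive (+-identityʳ _)) (≤-trans (length≤weight Is) weight≤K))) (<-irrefl refl)
      forced (suc m) Is weight≤K K< covers Y sorted large with any? (λ I → rank I ≟ 0) Is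
      -- A band of rank 0 asks for a single vertex.
      ... | yes trivial =
        Any.map (singleton (proj₂ (member Y (<-≤-trans (threshold>0 q>0 L>0 (suc m)) large)))) trivial
      ... | no ¬trivial
        with any? (λ v → any? (λ w → middles m <? count (λ x → bad? Is v x w) Y) Y) Y
      ...   | no ¬dense = contradiction sampled (λ (T , |T| , desc , good) → <⇒≱ L-large
              (≤-trans (≤-reflexive (sym |T|)) (≤-trans (bad-free-short Is covers T desc good)
                (^-monoʳ-≤ (suc q) (≤-trans (length≤weight Is) weight≤K)))))
        where
          -- Cut to exactly `L * (block m + block m)` vertices, since the averaging in `choose` also
          -- needs an upper bound on the number of candidates.
          Z : List ℕ
          Z = take (threshold (suc m)) Y

          |Z| : length Z ≡ threshold (suc m)
          |Z| = trans (length-take _ Y) (m≤n⇒m⊓n≡m large)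

          -- `block m` is chosen to make this an equality.
          room : (L * (block m + block m)) * (L * middles m) ≤ block m * block m
          room = ≤-reflexive (solve 2 (λ L M → (L :* (con 2 :* (L :* L :* M) :+ con 2 :* (L :* L :* M))) :* (L :* M)
                   := (con 2 :* (L :* L :* M)) :* (con 2 :* (L :* L :* M))) refl L (middles m))
            where open +-*-Solver

          open Sampling (bad? Is) proj₁ (middles m) L (block m) (block>0 q>0 L>0 m) room Y

          initial : Partial [] Z
          initial = record
            { descending = []
            ; chosen     = λ ()
            ; increasing = AllPairs.take⁺ _ sorted
            ; candidate  = ∈-take⁻ _ Y
            ; separated  = λ ()
            ; good       = λ ()
            ; extendable = λ ()
            ; sparse     = λ v∈ w∈ → ≤-trans (count-take _ (threshold (suc m)) Y)
                (≮⇒≥ (λ dense → ¬dense (lose v∈ (lose w∈ dense))))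
            }

          sampled : ∃ λ T → length T ≡ L × AllPairs (λ x y → y < x) T ×
                            (∀ {v x w} → v ∈ T → x ∈ T → w ∈ T → ¬ Bad Is v x w)
          sampled = sample L initial ≤-refl (≤-reflexive (sym |Z|)) (≤-reflexive |Z|)
      ...   | yes dense with find dense
      ...     | v , v∈Y , dense-v with find dense-v
      ...       | w , w∈Y , dense-vw
        -- The two factors `q` in `middles m` pay for two pigeonholes, first on the colour from `v`,
        -- then on the colour to `w`.
        with popular-value q (χ v) (filter (λ x → bad? Is v x w) Y) (λ _ → χ<q _ _) dense-vw
      ...         | d , dense-d
        with popular-value q (λ x → χ x w) (filter (λ x → χ v x ≟ d) (filter (λ x → bad? Is v x w) Y))
               (λ _ → χ<q _ _) dense-d
      ...           | c , dense-c = descend (member X (≤-<-trans z≤n dense-c))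
        where
          X : List ℕ
          X = filter (λ x → χ x w ≟ c) (filter (λ x → χ v x ≟ d) (filter (λ x → bad? Is v x w) Y))

          in-X : ∀ {x} → x ∈ X → x ∈ Y × Bad Is v x w × χ v x ≡ d × χ x w ≡ c
          in-X x∈ with ∈-filter⁻ (λ x → χ x w ≟ c) {xs = filter (λ x → χ v x ≟ d) (filter (λ x → bad? Is v x w) Y)} x∈
          ... | x∈₁ , xw with ∈-filter⁻ (λ x → χ v x ≟ d) {xs = filter (λ x → bad? Is v x w) Y} x∈₁
          ... | x∈₂ , vx with ∈-filter⁻ (λ x → bad? Is v x w) {xs = Y} x∈₂
          ... | x∈Y , bad = x∈Y , bad , vx , xw

          no-rank-zero : All (λ I → rank I ≢ 0) Is
          no-rank-zero = All.¬Any⇒All¬ Is ¬trivial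

          descend : ∃ (_∈ X) → Any (NonIncreasing Y) Is
          -- One member of `X` supplies `c ≤ d` and the common band `p`; these hold for all of `X`,
          -- whose members share both colours.
          descend (x , x∈X) with in-X x∈X
          ... | x∈Y , (_ , c≤d , p) , refl , refl = Extension.unsplit v∈Y w∈Y
            (λ y∈ → proj₁ (in-X y∈))
            (λ y∈ → proj₁ (proj₁ (proj₁ (proj₂ (in-X y∈)))))
            (λ y∈ → proj₂ (proj₁ (proj₁ (proj₂ (in-X y∈)))))
            (λ y∈ → proj₁ (proj₂ (proj₂ (in-X y∈))))
            (λ y∈ → proj₂ (proj₂ (proj₂ (in-X y∈))))
            c≤d no-rank-zero p
            (forced m (split p (χ x w)) (≤-trans (≤-reflexive (weight-split no-rank-zero p _)) weight≤K)
              (<-≤-trans K< (≤-reflexive (trans (+-suc (length Is) m) (cong (_+ m) (sym (length-split p _))))))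
              (λ e<q → Inside-split p _ (covers e<q)) X
              (AllPairs.filter⁺ _ (AllPairs.filter⁺ _ (AllPairs.filter⁺ _ sorted)))
              (<⇒≤ dense-c))

-- Replacing integer colours by ranks

module ColourRank {q : ℕ} (κ : Fin q → ℤ) where

  -- Defined for every integer, because pairs outside [N] may have any colour; the values run from 0
  -- to `q`, which makes `suc q` ranks.
  colour-rank : ℤ → ℕ
  colour-rank c = count (λ i → κ i ℤ.<? c) (allFin q)

  colour-rank≤ : ∀ c → colour-rank c ≤ q
  colour-rank≤ c = ≤-trans (length-filter _ (allFin q)) (≤-reflexive (length-tabulate id))

  -- If `κ i` were below `c`, the index `i` would be counted for `c` but not for `κ i`, making the
  -- rank of `c` strictly larger.
  reflects-≤ : ∀ {c i} → colour-rank c ≤ colour-rank (κ i) → c ≤ℤ κ i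
  reflects-≤ {c} {i} rank≤ = ℤ.≮⇒≥ (λ κi<c → <⇒≱ (count-strict (λ j → κ j ℤ.<? κ i) (λ j → κ j ℤ.<? c)
    (λ j κj<κi → ℤ.<-trans κj<κi κi<c) (∈-allFin i) κi<c (ℤ.<-irrefl refl)) rank≤)

  reflects-≡ : ∀ {i j} → colour-rank (κ i) ≡ colour-rank (κ j) → κ i ≡ κ j
  reflects-≡ eq = ℤ.≤-antisym (reflects-≤ (≤-reflexive eq)) (reflects-≤ (≤-reflexive (sym eq)))

as-function : ∀ {N s} (χ : Colouring) (S : List ℕ) → length S ≡ s → AllPairs _<_ S →
  (∀ {x} → x ∈ S → 1 ≤ x × x ≤ N) →
  (∀ {u v w} → u ∈ S → v ∈ S → w ∈ S → u < v → v < w → NonIncTriple χ u v w) →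
  Σ (Fin s → ℕ) λ T → IncSubset N s T × NonIncSet χ T
as-function χ S refl sorted range triples =
  lookup S
  , ((λ i → range (∈-lookup i)) , (λ i j i<j → AllPairs-lookup sorted i<j))
  , (λ i j k i<j j<k → triples (∈-lookup i) (∈-lookup j) (∈-lookup k)
      (AllPairs-lookup sorted i<j) (AllPairs-lookup sorted j<k))

-- The induction starts from one band of rank `r` with all `suc n` ranks. Its weight is `2 ^ r`,
-- which serves both as `K` and as the number of splits.
arrows : ∀ N r n L → suc (suc n) ^ 2 ^ r < L → Threshold.threshold (suc n) L (2 ^ r) ≤ N → Arrows N (suc r) n
arrows N r n L L-large large χ (κ , coloured)
  with forced ranked (suc n) (λ _ _ → s≤s (colour-rank≤ _)) (s≤s z≤n) (2 ^ r) L L-large (2 ^ r)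
         (band 0 (suc n) r ∷ []) (≤-reflexive (+-identityʳ _)) ≤-refl (λ e<q → here (z≤n , e<q))
         (applyUpTo suc N) (AllPairs.applyUpTo⁺₁ suc N (λ i<j _ → s≤s i<j))
         (≤-trans large (≤-reflexive (sym (length-applyUpTo suc N))))
  where
    open ColourRank κ
    ranked : ℕ → ℕ → ℕ
    ranked u v = colour-rank (χ u v)
... | here F = as-function χ members size sorted (range ∘ within) (λ u∈ v∈ w∈ u<v v<w →
    unranked (range (within u∈)) (range (within v∈)) (range (within w∈)) u<v v<w (triples u∈ v∈ w∈ u<v v<w))
  where
    open ColourRank κ
    open NonIncreasing F

    range : ∀ {x} → x ∈ applyUpTo suc N → 1 ≤ x × x ≤ N
    range x∈ with ∈-applyUpTo⁻ suc x∈
    ... | i , i<N , refl = s≤s z≤n , i<N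

    unranked : ∀ {u v w} → 1 ≤ u × u ≤ N → 1 ≤ v × v ≤ N → 1 ≤ w × w ≤ N → u < v → v < w →
               Triple (λ u v → colour-rank (χ u v)) u v w → NonIncTriple χ u v w
    unranked {u} {v} {w} (1≤u , _) (1≤v , v≤N) (_ , w≤N) u<v v<w
      with χ u v | coloured u v 1≤u u<v v≤N | χ u w | coloured u w 1≤u (<-trans u<v v<w) w≤N
         | χ v w | coloured v w 1≤v v<w w≤N
    ... | _ | i , refl | _ | j , refl | _ | k , refl =
      Sum.map (λ (eq , le) → reflects-≡ eq , reflects-≤ le) (λ (le , eq) → reflects-≤ le , reflects-≡ eq)

-- Numerical estimates and the final bound

binary-length : ∀ n → ∃ λ t → 2 ^ t ≤ suc n × suc n < 2 ^ suc t
binary-length zero = 0 , ≤-refl , ≤-refl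
binary-length (suc n) with binary-length n
... | t , lower , upper with suc (suc n) <? 2 ^ suc t
...   | yes below = t , m≤n⇒m≤1+n lower , below
...   | no ¬below = suc t , ≮⇒≥ ¬below , ≤-<-trans upper (^-monoʳ-< 2 ≤-refl (n<1+n (suc t)))

6≤[3+n]! : ∀ n → 6 ≤ (3 + n) !
6≤[3+n]! zero    = ≤-refl
6≤[3+n]! (suc n) = ≤-trans (6≤[3+n]! n) (m≤m+n _ _)

-- Since `K ≥ 4`, the left side is at most `12 * K ^ 2 = 192 * 4 ^ n`, while the right side is at
-- least `125 * 5 ^ n * 6`.
constant-bound : ∀ n → let K = 2 ^ (2 + n) in 3 * (K * (3 * K + 4)) ≤ 5 ^ (3 + n) * (3 + n) !
constant-bound n = begin
  3 * (K * (3 * K + 4))         ≤⟨ *-monoʳ-≤ 3 (*-monoʳ-≤ K (+-monoʳ-≤ (3 * K) (^-monoʳ-≤ 2 (m≤m+n 2 n)))) ⟩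
  3 * (K * (3 * K + K))         ≡⟨ solve 1 (λ x → let K = con 2 :* (con 2 :* x) in
                                     con 3 :* (K :* (con 3 :* K :+ K)) := con 192 :* (x :* x)) refl (2 ^ n) ⟩
  192 * (2 ^ n * 2 ^ n)         ≡⟨ cong (192 *_) 2^n*2^n≡4^n ⟩
  192 * 4 ^ n                   ≤⟨ *-mono-≤ (m≤m+n 192 558) (^-monoˡ-≤ n (m≤m+n 4 1)) ⟩
  750 * 5 ^ n                   ≡⟨ solve 1 (λ x → con 750 :* x := (con 125 :* x) :* con 6) refl (5 ^ n) ⟩
  (125 * 5 ^ n) * 6             ≡⟨ cong (_* 6) (^-distribˡ-+-* 5 3 n) ⟨
  5 ^ (3 + n) * 6               ≤⟨ *-monoʳ-≤ (5 ^ (3 + n)) (6≤[3+n]! n) ⟩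
  5 ^ (3 + n) * (3 + n) !       ∎
  where
    open ≤-Reasoning
    open +-*-Solver
    K = 2 ^ (2 + n)
    2^n*2^n≡4^n : 2 ^ n * 2 ^ n ≡ 4 ^ n
    2^n*2^n≡4^n = trans (sym (^-distribˡ-+-* 2 n n))
      (trans (cong (λ m → 2 ^ (n + m)) (sym (+-identityʳ n))) (sym (^-*-assoc 2 2 n)))

2^-reflects-< : ∀ {m n} → 2 ^ m < 2 ^ n → m < n
2^-reflects-< 2^m<2^n = ≰⇒> (λ n≤m → <⇒≱ 2^m<2^n (^-monoʳ-≤ 2 n≤m))

theorem2p3 : (s n : ℕ) → 3 ≤ s → 2 ≤ n →
    Σ ℕ λ N → Arrows N s n × BoundedByTwoPow N (5 ^ s * s !) n (s ∸ 2)
theorem2p3 (suc (suc (suc s))) (suc (suc n)) (s≤s (s≤s (s≤s z≤n))) (s≤s (s≤s z≤n)) with binary-length (suc n)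
-- There are at least two colours, so the integer part of the logarithm is positive.
... | zero  , _ , s≤s (s≤s ())
... | suc t , lower , upper = 2 ^ (τ * (3 * K + 4) * K) , arrows _ (2 + s) (2 + n) L L-large N-large , bounded
  where
    K τ L : ℕ
    K = 2 ^ (2 + s)
    -- With `3 + n` ranks there are at most `(4 + n) ^ K` peak vectors. `τ` is the integer part of
    -- the logarithm of `2 + n` plus 2, enough for `4 + n ≤ 2 ^ τ`; the extra bit in `L` makes the
    -- inequality strict.
    τ = 3 + t
    L = 2 ^ suc (τ * K)

    n+4≤2^τ : 4 + n ≤ 2 ^ τ
    n+4≤2^τ = ≤-trans (+-mono-≤ (≤-trans (s≤s (s≤s z≤n)) (<⇒≤ upper)) (<⇒≤ upper))
      (≤-reflexive (cong (2 ^ (2 + t) +_) (sym (+-identityʳ _))))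

    L-large : (4 + n) ^ K < L
    L-large = ≤-<-trans (^-monoˡ-≤ K n+4≤2^τ)
      (≤-<-trans (≤-reflexive (^-*-assoc 2 τ K)) (^-monoʳ-< 2 ≤-refl (n<1+n (τ * K))))

    exponent≤ : let l = suc (τ * K) in 2 + (l + l + l) + (τ + τ) ≤ τ * (3 * K + 4)
    exponent≤ = ≤-trans (m≤m+n _ (1 + 2 * t)) (≤-reflexive
      (solve 2 (λ t K → let l = con 1 :+ (con 3 :+ t) :* K in
        (con 2 :+ (l :+ l :+ l) :+ ((con 3 :+ t) :+ (con 3 :+ t))) :+ (con 1 :+ con 2 :* t)
          := (con 3 :+ t) :* (con 3 :* K :+ con 4)) refl t K))
      where open +-*-Solver

    N-large : Threshold.threshold (3 + n) L K ≤ 2 ^ (τ * (3 * K + 4) * K)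
    N-large = ≤-trans (Threshold.threshold≤2^ (3 + n) L (suc (τ * K)) τ ≤-refl (≤-trans (n≤1+n _) n+4≤2^τ) K)
      (^-monoʳ-≤ 2 (*-monoˡ-≤ K exponent≤))

    bounded : BoundedByTwoPow (2 ^ (τ * (3 * K + 4) * K)) (5 ^ (3 + s) * (3 + s) !) (2 + n) (suc s)
    bounded p q 1≤q n^q<2^p = begin
      (2 ^ (τ * (3 * K + 4) * K)) ^ (q ^ suc s)       ≡⟨ ^-*-assoc 2 (τ * (3 * K + 4) * K) (q ^ suc s) ⟩
      2 ^ (τ * (3 * K + 4) * K * (q * q ^ s))         ≤⟨ ^-monoʳ-≤ 2 exponents ⟩
      2 ^ (5 ^ (3 + s) * (3 + s) ! * (p * p ^ s))     ∎
      where
        open ≤-Reasoning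
        [1+t]q<p : suc t * q < p
        [1+t]q<p = 2^-reflects-< (≤-<-trans (≤-reflexive (sym (^-*-assoc 2 (suc t) q)))
          (≤-<-trans (^-monoˡ-≤ q lower) n^q<2^p))

        q≤p : q ≤ p
        q≤p = ≤-trans (m≤m+n q (t * q)) (<⇒≤ [1+t]q<p)

        -- Here `τ` is split as `1 + 1 + suc t`.
        τq≤3p : τ * q ≤ 3 * p
        τq≤3p = +-mono-≤ q≤p (+-mono-≤ q≤p (≤-trans (<⇒≤ [1+t]q<p) (m≤m+n p 0)))

        -- The exponent of N is linear in `τ`: one factor `p` absorbs `τ * q`, and the other `s`
        -- factors come from `q ≤ p`.
        exponents : τ * (3 * K + 4) * K * (q * q ^ s) ≤ 5 ^ (3 + s) * (3 + s) ! * (p * p ^ s)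
        exponents = begin
          τ * (3 * K + 4) * K * (q * q ^ s)           ≡⟨ solve 5 (λ τ A K q y →
            τ :* A :* K :* (q :* y) := (τ :* q) :* (K :* A) :* y) refl τ (3 * K + 4) K q (q ^ s) ⟩
          (τ * q) * (K * (3 * K + 4)) * q ^ s         ≤⟨ *-mono-≤ (*-monoˡ-≤ (K * (3 * K + 4)) τq≤3p) (^-monoˡ-≤ s q≤p) ⟩
          (3 * p) * (K * (3 * K + 4)) * p ^ s         ≡⟨ solve 3 (λ p B y →
            (con 3 :* p) :* B :* y := (con 3 :* B) :* (p :* y)) refl p (K * (3 * K + 4)) (p ^ s) ⟩
          (3 * (K * (3 * K + 4))) * (p * p ^ s)       ≤⟨ *-monoˡ-≤ (p * p ^ s) (constant-bound s) ⟩
          5 ^ (3 + s) * (3 + s) ! * (p * p ^ s)       ∎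
          where open +-*-Solver
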